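{- Let $w_1,w_2$ be positive integers such that $r$ divides neither $w_1$ nor $w_2$. Then for every integer $n\ge 0$, as an identity of polynomials in $y_1,y_2$, $$\sum_{k=0}^{n}\binom{n}{k}B_{k,\chi,\xi^{w_1}}(w_2y_1)\,B_{n-k,\chi,\xi^{w_2}}(w_1y_2)\,w_1^{k}w_2^{n-k}=\sum_{k=0}^{n}\binom{n}{k}B_{k,\chi,\xi^{w_2}}(w_1y_1)\,B_{n-k,\chi,\xi^{w_1}}(w_2y_2)\,w_2^{k}w_1^{n-k}.$$
   Context: Let $p$ be a prime, $\mathbb{C}_p$ the completion of an algebraic closure of $\mathbb{Q}_p$, $d$ a positive integer, and $\chi$ a primitive Dirichlet character of conductor $d$, with values viewed in $\mathbb{C}_p$ via a fixed embedding $\overline{\mathbb{Q}}\to\mathbb{C}_p$ (as usual $\chi(a)=0$ if $\gcd(a,d)>1$; for $d=1$, $\chi\equiv 1$). Let $r$ be a positive integer with $\gcd(r,pd)=1$ and let $\xi\neq 1$ in $\mathbb{C}_p$ be an $r$-th root of unity. For a root of unity $\eta\in\mathbb{C}_p$, the generalized twisted Bernoulli polynomials $B_{n,\chi,\eta}(x)$ attached to $\chi$ and $\eta$ are defined by the power series identity $$\frac{t\,e^{xt}}{\eta^{d}e^{dt}-1}\sum_{a=0}^{d-1}\chi(a)\eta^{a}e^{at}=\sum_{n=0}^{\infty}B_{n,\chi,\eta}(x)\frac{t^{n}}{n!}.$$ (The left side is a power series in $t$ with coefficients in $\mathbb{C}_p[x]$, for any $\eta$.) -}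

module Defs where

open import Algebra.Apartness.Bundles using (HeytingField; module HeytingCommutativeRing)
open import Algebra.Bundles using (CommutativeRing)
open import Algebra.Morphism.Structures using (module RingMorphisms)
open import Data.Fin.Base using (Fin; toℕ; zero; suc)
open import Data.Integer.Base as ℤ using (ℤ; +_)
open import Data.Integer.Coprimality using (Coprime)
import Data.Integer.Divisibility as ℤ using (_∣_)
open import Data.Nat.Base as ℕ using (ℕ; zero; suc; _∸_; _!)
import Data.Nat.Divisibility as ℕ using (_∣_)
import Data.Nat.Properties as ℕ
open import Data.Product.Base using (_,_; Σ-syntax; ∃-syntax)
open import Data.Rational.Base as ℚ using (ℚ; 0ℚ; 1ℚ; _/_)
import Data.Rational.Properties as ℚ
open import Function.Base using (_∘_)
open import Level using (_⊔_) renaming (suc to lsuc)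
open import Relation.Binary.PropositionalEquality.Core as ≡ using (_≡_)
open import Relation.Nullary.Decidable using (yes; no)
open import Relation.Nullary.Negation using (¬_)

module PowerSeries {c ℓ} (R : CommutativeRing c ℓ) where
  open CommutativeRing R hiding (_-_)
  open import Algebra.Properties.AbelianGroup +-abelianGroup using (⁻¹-∙-comm)
  open import Algebra.Properties.Semiring.Sum semiring
  open import Relation.Binary.Reasoning.Setoid setoid

  Series : Set c
  Series = ℕ → Carrier

  infix 4 _≈ˢ_
  _≈ˢ_ : Series → Series → Set ℓ
  f ≈ˢ g = ∀ n → f n ≈ g n

  constant : Carrier → Series
  constant a zero    = a
  constant a (suc n) = 0#

  indeterminate : Series
  indeterminate zero          = 0#
  indeterminate (suc zero)    = 1#
  indeterminate (suc (suc n)) = 0#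

  infixl 6 _+ˢ_
  _+ˢ_ : Series → Series → Series
  (f +ˢ g) n = f n + g n

  -ˢ_ : Series → Series
  (-ˢ f) n = - f n

  infixl 7 _*ˢ_
  _*ˢ_ : Series → Series → Series
  (f *ˢ g) n = ∑[ i ≤ n ] (f (toℕ i) * g (n ∸ toℕ i))

  *ˢ-cong : ∀ {f f′ g g′} → f ≈ˢ f′ → g ≈ˢ g′ → f *ˢ g ≈ˢ f′ *ˢ g′
  *ˢ-cong f≈f′ g≈g′ n = sum-cong-≋ {suc n} (λ i → *-cong (f≈f′ (toℕ i)) (g≈g′ (n ∸ toℕ i)))

  *ˢ-scaleˡ : ∀ a f g n → ((λ i → a * f i) *ˢ g) n ≈ a * (f *ˢ g) n
  *ˢ-scaleˡ a f g n =
    trans (sum-cong-≋ {suc n} (λ i → *-assoc a (f (toℕ i)) (g (n ∸ toℕ i))))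
          (sym (*-distribˡ-sum {suc n} a (λ i → f (toℕ i) * g (n ∸ toℕ i))))

  *ˢ-distribʳ : ∀ h f g → (f +ˢ g) *ˢ h ≈ˢ f *ˢ h +ˢ g *ˢ h
  *ˢ-distribʳ h f g n =
    trans (sum-cong-≋ {suc n} (λ i → distribʳ (h (n ∸ toℕ i)) (f (toℕ i)) (g (toℕ i))))
          (∑-distrib-+ {suc n} (λ i → f (toℕ i) * h (n ∸ toℕ i)) (λ i → g (toℕ i) * h (n ∸ toℕ i)))

  *ˢ-last : ∀ f g n → (f *ˢ g) (suc n) ≈ f (suc n) * g 0 + (f *ˢ (g ∘ suc)) n
  *ˢ-last f g zero = begin
    f 0 * g 1 + (f 1 * g 0 + 0#)  ≈⟨ +-congˡ (+-identityʳ _) ⟩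
    f 0 * g 1 + f 1 * g 0         ≈⟨ +-comm _ _ ⟩
    f 1 * g 0 + f 0 * g 1         ≈⟨ +-congˡ (+-identityʳ _) ⟨
    f 1 * g 0 + (f 0 * g 1 + 0#)  ∎
  *ˢ-last f g (suc n) = begin
    a + ((f ∘ suc) *ˢ g) (suc n)                ≈⟨ +-congˡ (*ˢ-last (f ∘ suc) g n) ⟩
    a + (b + ((f ∘ suc) *ˢ (g ∘ suc)) n)        ≈⟨ +-assoc a b _ ⟨
    (a + b) + ((f ∘ suc) *ˢ (g ∘ suc)) n        ≈⟨ +-congʳ (+-comm a b) ⟩
    (b + a) + ((f ∘ suc) *ˢ (g ∘ suc)) n        ≈⟨ +-assoc b a _ ⟩
    b + (a + ((f ∘ suc) *ˢ (g ∘ suc)) n)        ∎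
    where
    a = f 0 * g (suc (suc n))
    b = f (suc (suc n)) * g 0

  *ˢ-comm : ∀ f g → f *ˢ g ≈ˢ g *ˢ f
  *ˢ-comm f g zero    = +-congʳ (*-comm (f 0) (g 0))
  *ˢ-comm f g (suc n) = begin
    f 0 * g (suc n) + ((f ∘ suc) *ˢ g) n  ≈⟨ +-cong (*-comm _ _) (*ˢ-comm (f ∘ suc) g n) ⟩
    g (suc n) * f 0 + (g *ˢ (f ∘ suc)) n  ≈⟨ *ˢ-last g f n ⟨
    (g *ˢ f) (suc n)                      ∎

  *ˢ-assoc : ∀ f g h → (f *ˢ g) *ˢ h ≈ˢ f *ˢ (g *ˢ h)
  *ˢ-assoc f g h zero = +-congʳ (begin
    (f 0 * g 0 + 0#) * h 0  ≈⟨ *-congʳ (+-identityʳ _) ⟩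
    f 0 * g 0 * h 0         ≈⟨ *-assoc _ _ _ ⟩
    f 0 * (g 0 * h 0)       ≈⟨ *-congˡ (+-identityʳ _) ⟨
    f 0 * (g 0 * h 0 + 0#)  ∎)
  *ˢ-assoc f g h (suc n) = begin
    (f 0 * g 0 + 0#) * h (suc n) + (((f *ˢ g) ∘ suc) *ˢ h) n
      ≈⟨ +-cong (*-congʳ (+-identityʳ _)) (*ˢ-distribʳ h (λ i → f 0 * g (suc i)) ((f ∘ suc) *ˢ g) n) ⟩
    f 0 * g 0 * h (suc n) + (((λ i → f 0 * g (suc i)) *ˢ h) n + (((f ∘ suc) *ˢ g) *ˢ h) n)
      ≈⟨ +-cong (*-assoc _ _ _) (+-cong (*ˢ-scaleˡ (f 0) (g ∘ suc) h n) (*ˢ-assoc (f ∘ suc) g h n)) ⟩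
    f 0 * (g 0 * h (suc n)) + (f 0 * ((g ∘ suc) *ˢ h) n + ((f ∘ suc) *ˢ (g *ˢ h)) n)
      ≈⟨ +-assoc _ _ _ ⟨
    f 0 * (g 0 * h (suc n)) + f 0 * ((g ∘ suc) *ˢ h) n + ((f ∘ suc) *ˢ (g *ˢ h)) n
      ≈⟨ +-congʳ (distribˡ _ _ _) ⟨
    f 0 * (g *ˢ h) (suc n) + ((f ∘ suc) *ˢ (g *ˢ h)) n ∎

  *ˢ-identityˡ : ∀ f → constant 1# *ˢ f ≈ˢ f
  *ˢ-identityˡ f n = begin
    1# * f n + ∑[ i < n ] (0# * f (n ∸ suc (toℕ i)))
      ≈⟨ +-cong (*-identityˡ _) (sum-cong-≋ {n} (λ i → zeroˡ (f (n ∸ suc (toℕ i))))) ⟩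
    f n + ∑[ i < n ] 0#  ≈⟨ +-congˡ (sum-replicate-zero n) ⟩
    f n + 0#             ≈⟨ +-identityʳ _ ⟩
    f n                  ∎

  powerSeriesRing : CommutativeRing c ℓ
  powerSeriesRing = record
    { Carrier = Series
    ; _≈_     = _≈ˢ_
    ; _+_     = _+ˢ_
    ; _*_     = _*ˢ_
    ; -_      = -ˢ_
    ; 0#      = λ _ → 0#
    ; 1#      = constant 1#
    ; isCommutativeRing = record
      { isRing = record
        { +-isAbelianGroup = record
          { isGroup = record
            { isMonoid = record
              { isSemigroup = record
                { isMagma = record
                  { isEquivalence = record
                    { refl  = λ _ → refl
                    ; sym   = λ p n → sym (p n)
                    ; trans = λ p q n → trans (p n) (q n)
                    }
                  ; ∙-cong = λ p q n → +-cong (p n) (q n)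
                  }
                ; assoc = λ f g h n → +-assoc (f n) (g n) (h n)
                }
              ; identity = (λ f n → +-identityˡ (f n)) , (λ f n → +-identityʳ (f n))
              }
            ; inverse = (λ f n → -‿inverseˡ (f n)) , (λ f n → -‿inverseʳ (f n))
            ; ⁻¹-cong = λ p n → -‿cong (p n)
            }
          ; comm = λ f g n → +-comm (f n) (g n)
          }
        ; *-cong     = *ˢ-cong
        ; *-assoc    = *ˢ-assoc
        ; *-identity = *ˢ-identityˡ
                     , λ f n → trans (*ˢ-comm f (constant 1#) n) (*ˢ-identityˡ f n)
        ; distrib    = (λ h f g n → trans (*ˢ-comm h (f +ˢ g) n)
                          (trans (*ˢ-distribʳ h f g n)
                            (+-cong (*ˢ-comm f h n) (*ˢ-comm g h n))))
                     , *ˢ-distribʳ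
        }
      ; *-comm = *ˢ-comm
      }
    }

-- Polynomials are the power series with finitely many nonzero coefficients.
module Polynomials {c ℓ} (R : CommutativeRing c ℓ) where
  open CommutativeRing R hiding (_-_)
  open import Algebra.Properties.Group +-group using (ε⁻¹≈ε)
  open import Algebra.Properties.Semiring.Sum semiring
  open PowerSeries R

  -- `bound` is any upper bound on the number of coefficients, not the degree.
  record Polynomial : Set (c ⊔ ℓ) where
    field
      coefficient : Series
      bound       : ℕ
      vanishes    : ∀ n → bound ℕ.≤ n → coefficient n ≈ 0#
  open Polynomial

  infix 4 _≈ᵖ_
  _≈ᵖ_ : Polynomial → Polynomial → Set ℓ
  p ≈ᵖ q = coefficient p ≈ˢ coefficient q

  C : Carrier → Polynomial
  C a = record
    { coefficient = constant a
    ; bound       = 1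
    ; vanishes    = λ { (suc n) _ → refl }
    }

  X : Polynomial
  X = record
    { coefficient = indeterminate
    ; bound       = 2
    ; vanishes    = λ { (suc zero) (ℕ.s≤s ()) ; (suc (suc n)) _ → refl }
    }

  0ᵖ : Polynomial
  0ᵖ = record { coefficient = λ _ → 0# ; bound = 0 ; vanishes = λ _ _ → refl }

  infixl 6 _+ᵖ_
  _+ᵖ_ : Polynomial → Polynomial → Polynomial
  p +ᵖ q = record
    { coefficient = coefficient p +ˢ coefficient q
    ; bound       = bound p ℕ.⊔ bound q
    ; vanishes    = λ n b≤n → trans
        (+-cong (vanishes p n (ℕ.≤-trans (ℕ.m≤m⊔n _ _) b≤n))
                (vanishes q n (ℕ.≤-trans (ℕ.m≤n⊔m _ _) b≤n)))
        (+-identityˡ 0#)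
    }

  -ᵖ_ : Polynomial → Polynomial
  -ᵖ p = record
    { coefficient = -ˢ coefficient p
    ; bound       = bound p
    ; vanishes    = λ n b≤n → trans (-‿cong (vanishes p n b≤n)) ε⁻¹≈ε
    }

  infixl 7 _*ᵖ_
  _*ᵖ_ : Polynomial → Polynomial → Polynomial
  p *ᵖ q = record
    { coefficient = coefficient p *ˢ coefficient q
    ; bound       = bound p ℕ.+ bound q
    ; vanishes    = λ n b≤n → trans
        (sum-cong-≋ {suc n} (λ i → termVanishes n b≤n (toℕ i)))
        (sum-replicate-zero (suc n))
    }
    where
    termVanishes : ∀ n → bound p ℕ.+ bound q ℕ.≤ n → ∀ i →
                   coefficient p i * coefficient q (n ∸ i) ≈ 0#
    termVanishes n b≤n i with bound p ℕ.≤? i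
    ... | yes bp≤i = trans (*-congʳ (vanishes p i bp≤i)) (zeroˡ _)
    ... | no  bp≰i = trans (*-congˡ (vanishes q (n ∸ i)
      (ℕ.m+n≤o⇒m≤o∸n (bound q)
        (ℕ.≤-trans (ℕ.+-monoʳ-≤ (bound q) (ℕ.<⇒≤ (ℕ.≰⇒> bp≰i)))
          (ℕ.≤-trans (ℕ.≤-reflexive (ℕ.+-comm (bound q) (bound p))) b≤n))))) (zeroʳ _)

  polynomialRing : CommutativeRing (c ⊔ ℓ) ℓ
  polynomialRing = record
    { Carrier = Polynomial
    ; _≈_     = _≈ᵖ_
    ; _+_     = _+ᵖ_
    ; _*_     = _*ᵖ_
    ; -_      = -ᵖ_
    ; 0#      = 0ᵖ
    ; 1#      = C 1#
    ; isCommutativeRing = record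
      { isRing = record
        { +-isAbelianGroup = record
          { isGroup = record
            { isMonoid = record
              { isSemigroup = record
                { isMagma = record
                  { isEquivalence = record
                    { refl  = λ _ → refl
                    ; sym   = λ p n → sym (p n)
                    ; trans = λ p q n → trans (p n) (q n)
                    }
                  ; ∙-cong = λ p q n → +-cong (p n) (q n)
                  }
                ; assoc = λ p q r → S.+-assoc (coefficient p) (coefficient q) (coefficient r)
                }
              ; identity = (λ p → S.+-identityˡ (coefficient p)) , (λ p → S.+-identityʳ (coefficient p))
              }
            ; inverse = (λ p → S.-‿inverseˡ (coefficient p)) , (λ p → S.-‿inverseʳ (coefficient p))
            ; ⁻¹-cong = λ p n → -‿cong (p n)
            }
          ; comm = λ p q → S.+-comm (coefficient p) (coefficient q)
          }
        ; *-cong     = *ˢ-cong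
        ; *-assoc    = λ p q r → S.*-assoc (coefficient p) (coefficient q) (coefficient r)
        ; *-identity = (λ p → S.*-identityˡ (coefficient p)) , (λ p → S.*-identityʳ (coefficient p))
        ; distrib    = (λ p q r → S.distribˡ (coefficient p) (coefficient q) (coefficient r))
                     , (λ p q r → S.distribʳ (coefficient p) (coefficient q) (coefficient r))
        }
      ; *-comm = λ p q → S.*-comm (coefficient p) (coefficient q)
      }
    }
    where module S = CommutativeRing powerSeriesRing

  -- The value at s of the polynomial whose coefficients are pushed along φ.
  module Evaluation {c′ ℓ′} (S : CommutativeRing c′ ℓ′) (φ : Carrier → CommutativeRing.Carrier S) where
    private
      module S = CommutativeRing S
    open import Algebra.Properties.Semiring.Exp S.semiring using () renaming (_^_ to _^ˢ_)
    open import Algebra.Properties.Semiring.Sum S.semiring using () renaming (sum to sumˢ)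

    eval : Polynomial → S.Carrier → S.Carrier
    eval p s = sumˢ {bound p} (λ i → φ (coefficient p (toℕ i)) S.* s ^ˢ toℕ i)

ringOf : ∀ {c ℓ₁ ℓ₂} → HeytingField c ℓ₁ ℓ₂ → CommutativeRing c ℓ₁
ringOf K = HeytingCommutativeRing.commutativeRing (HeytingField.heytingCommutativeRing K)

record FieldEmbedding {a a₁ a₂ b b₁ b₂} (K : HeytingField a a₁ a₂) (L : HeytingField b b₁ b₂)
       : Set (a ⊔ a₁ ⊔ b ⊔ b₁) where
  private
    module K = HeytingField K
    module L = HeytingField L
  open RingMorphisms (CommutativeRing.rawRing (ringOf K)) (CommutativeRing.rawRing (ringOf L))
  field
    ⟦_⟧               : K.Carrier → L.Carrier
    isRingHomomorphism : IsRingHomomorphism ⟦_⟧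

-- x ^ n + ∑_{i < n} a i * x ^ i
monic : ∀ {c ℓ₁ ℓ₂} (K : HeytingField c ℓ₁ ℓ₂) (let open HeytingField K) →
        ∀ n → (Fin n → Carrier) → Carrier → Carrier
monic K n a x = x ^ n + ∑[ i < n ] (a i * x ^ toℕ i)
  where
  open CommutativeRing (ringOf K)
  open import Algebra.Properties.Semiring.Exp semiring using (_^_)
  open import Algebra.Properties.Semiring.Sum semiring using (sum-syntax)

record IsAlgebraicClosure {a a₁ a₂ b b₁ b₂} {K : HeytingField a a₁ a₂} {L : HeytingField b b₁ b₂}
                          (ι : FieldEmbedding K L) : Set (a ⊔ b ⊔ b₁) where
  private
    module K = HeytingField K
    module L = HeytingField L
  open FieldEmbedding ι
  field
    algebraic : ∀ x → Σ[ n ∈ ℕ ] Σ[ a ∈ (Fin (suc n) → K.Carrier) ] monic L (suc n) (λ i → ⟦ a i ⟧) x L.≈ L.0#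
    closed    : ∀ n (a : Fin (suc n) → L.Carrier) → ∃[ x ] monic L (suc n) a x L.≈ L.0#

-- Valued fields with additive valuation in ℚ, i.e. ∣ x ∣ₚ = p ^ (- v x)
record ValuedField c ℓ₁ ℓ₂ : Set (lsuc (c ⊔ ℓ₁ ⊔ ℓ₂)) where
  field
    field′ : HeytingField c ℓ₁ ℓ₂
  open HeytingField field′ public
  field
    v      : ∀ x → x # 0# → ℚ
    v-cong : ∀ {x y} (x#0 : x # 0#) (y#0 : y # 0#) → x ≈ y → v x x#0 ≡ v y y#0
    v-*    : ∀ {x y} (x#0 : x # 0#) (y#0 : y # 0#) (xy#0 : x * y # 0#) →
             v (x * y) xy#0 ≡ v x x#0 ℚ.+ v y y#0
    v-+    : ∀ {x y} (x#0 : x # 0#) (y#0 : y # 0#) (x+y#0 : x + y # 0#) →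
             v x x#0 ℚ.⊓ v y y#0 ℚ.≤ v (x + y) x+y#0

  -- v x ≥ q, with the convention v 0 = ∞
  V≥ : ℚ → Carrier → Set ℓ₂
  V≥ q x = ∀ (x#0 : x # 0#) → q ℚ.≤ v x x#0

  IsCauchy : (ℕ → Carrier) → Set ℓ₂
  IsCauchy s = ∀ q → ∃[ N ] (∀ m n → N ℕ.≤ m → N ℕ.≤ n → V≥ q (s m - s n))

  ConvergesTo : (ℕ → Carrier) → Carrier → Set ℓ₂
  ConvergesTo s l = ∀ q → ∃[ N ] (∀ n → N ℕ.≤ n → V≥ q (s n - l))

-- L is the completion of K for the restriction to K of the valuation of L.
record IsCompletion {a a₁ a₂ b b₁ b₂} {K : HeytingField a a₁ a₂} (L : ValuedField b b₁ b₂)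
                    (ι : FieldEmbedding K (ValuedField.field′ L)) : Set (a ⊔ b ⊔ b₂) where
  open FieldEmbedding ι
  open ValuedField L
  field
    complete : ∀ s → IsCauchy s → ∃[ l ] ConvergesTo s l
    dense    : ∀ x q → ∃[ y ] V≥ q (x - ⟦ y ⟧)

IsValuationPreserving : ∀ {a a₁ a₂ b b₁ b₂} (K : ValuedField a a₁ a₂) (L : ValuedField b b₁ b₂) →
                        FieldEmbedding (ValuedField.field′ K) (ValuedField.field′ L) → Set (a ⊔ a₂ ⊔ b₂)
IsValuationPreserving K L ι = ∀ x x#0 ιx#0 → L.v ⟦ x ⟧ ιx#0 ≡ K.v x x#0
  where
  module K = ValuedField K
  module L = ValuedField L
  open FieldEmbedding ι

-- The tower ℚ ⊂ ℚₚ ⊂ ℚ̄ₚ ⊂ ℂₚ: completion, algebraic closure, completion.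
record ComplexPadics (p : ℕ) c ℓ₁ ℓ₂ : Set (lsuc (c ⊔ ℓ₁ ⊔ ℓ₂)) where
  field
    ℚₚ ℚ̄ₚ ℂₚ : ValuedField c ℓ₁ ℓ₂
  module ℚₚ = ValuedField ℚₚ
  module ℚ̄ₚ = ValuedField ℚ̄ₚ
  module ℂₚ = ValuedField ℂₚ
  field
    ℚ↪ℚₚ  : FieldEmbedding ℚ.heytingField ℚₚ.field′
    ℚₚ↪ℚ̄ₚ : FieldEmbedding ℚₚ.field′ ℚ̄ₚ.field′
    ℚ̄ₚ↪ℂₚ : FieldEmbedding ℚ̄ₚ.field′ ℂₚ.field′
  module ℚ↪ℚₚ  = FieldEmbedding ℚ↪ℚₚ
  module ℚₚ↪ℚ̄ₚ = FieldEmbedding ℚₚ↪ℚ̄ₚ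
  module ℚ̄ₚ↪ℂₚ = FieldEmbedding ℚ̄ₚ↪ℂₚ
  field
    -- By multiplicativity these determine v on ℚ: it is the p-adic valuation.
    v-p              : ∀ p#0 → ℚₚ.v ℚ↪ℚₚ.⟦ + p / 1 ⟧ p#0 ≡ 1ℚ
    v-unit           : ∀ m → ¬ p ℕ.∣ m → ∀ m#0 → ℚₚ.v ℚ↪ℚₚ.⟦ + m / 1 ⟧ m#0 ≡ 0ℚ
    ℚₚ-completion    : IsCompletion ℚₚ ℚ↪ℚₚ
    ℚ̄ₚ-closure       : IsAlgebraicClosure ℚₚ↪ℚ̄ₚ
    ℚₚ↪ℚ̄ₚ-valuation  : IsValuationPreserving ℚₚ ℚ̄ₚ ℚₚ↪ℚ̄ₚ
    ℂₚ-completion    : IsCompletion ℂₚ ℚ̄ₚ↪ℂₚ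
    ℚ̄ₚ↪ℂₚ-valuation  : IsValuationPreserving ℚ̄ₚ ℂₚ ℚ̄ₚ↪ℂₚ

  ℚ→ℂₚ : ℚ → ℂₚ.Carrier
  ℚ→ℂₚ q = ℚ̄ₚ↪ℂₚ.⟦ ℚₚ↪ℚ̄ₚ.⟦ ℚ↪ℚₚ.⟦ q ⟧ ⟧ ⟧

record DirichletCharacter {c ℓ₁ ℓ₂} (L : HeytingField c ℓ₁ ℓ₂) (d : ℕ) : Set (c ⊔ ℓ₁) where
  open HeytingField L
  field
    χ          : ℤ → Carrier
    χ-periodic : ∀ a → χ (a ℤ.+ + d) ≈ χ a
    χ-*        : ∀ a b → χ (a ℤ.* b) ≈ χ a * χ b
    χ-1        : χ (+ 1) ≈ 1#
    χ-0        : ∀ a → ¬ Coprime a (+ d) → χ a ≈ 0#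

  -- χ restricted to units factors through (ℤ/m)ˣ; the conductor is the least such m ∣ d.
  InducedModulus : ℕ → Set ℓ₁
  InducedModulus m = ∀ a → Coprime a (+ d) → + m ℤ.∣ (a ℤ.- + 1) → χ a ≈ 1#

  IsPrimitive : Set ℓ₁
  IsPrimitive = ∀ m → m ℕ.∣ d → InducedModulus m → m ≡ d

-- ι makes K a ℚ-algebra; it only serves to write 1 / n! in K.
module TwistedBernoulli {c ℓ} (K : CommutativeRing c ℓ) (ι : ℚ → CommutativeRing.Carrier K) where
  private
    module K = CommutativeRing K
  open import Algebra.Properties.Semiring.Exp K.semiring using (_^_)
  open Polynomials K public using (Polynomial; C; X; polynomialRing)
  private
    module K[x] = CommutativeRing polynomialRing
  open import Algebra.Properties.Semiring.Exp K[x].semiring using () renaming (_^_ to _^ˣ_)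
  open import Algebra.Properties.Semiring.Mult K[x].semiring using () renaming (_×_ to _×ˣ_)
  open PowerSeries polynomialRing using (Series; constant; indeterminate; powerSeriesRing)
  private
    module K[x]⟦t⟧ = CommutativeRing powerSeriesRing
  open K[x]⟦t⟧ using (_*_; _-_; _≈_; 1#)
  open import Algebra.Properties.Semiring.Sum K[x]⟦t⟧.semiring using (sum-syntax)

  -- ∑ₙ bₙ tⁿ / n!
  egf : (ℕ → Polynomial) → Series
  egf b n = C (ι ((+ 1 / n !) {{n ℕ.!≢0}})) K[x].* b n

  -- e ^ (u t)
  exp : Polynomial → Series
  exp u = egf (u ^ˣ_)

  scalar : K.Carrier → Series
  scalar a = constant (C a)

  natural : ℕ → Polynomial
  natural m = m ×ˣ K[x].1#

  -- ∑ₙ Bₙ(x) tⁿ/n! = t e^(xt) ∑_{a<d} χ(a) ηᵃ e^(at) / (η^d e^(dt) - 1), with the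
  -- denominator cleared.  When K is a field and η ≠ 0 this determines B: the
  -- t-coefficient η^d d of the denominator is invertible, so the denominator
  -- is not a zero divisor.
  IsTwistedBernoulli : (d : ℕ) (χ : ℤ → K.Carrier) (η : K.Carrier) (B : ℕ → Polynomial) → Set ℓ
  IsTwistedBernoulli d χ η B =
    (scalar (η ^ d) * exp (natural d) - 1#) * egf B
      ≈ indeterminate * exp X *
        ∑[ a < d ] (scalar (χ (+ toℕ a)) * scalar (η ^ toℕ a) * exp (natural (toℕ a)))

  K[y₁] : CommutativeRing (c ⊔ ℓ) ℓ
  K[y₁] = polynomialRing
  open Polynomials K[y₁] using () renaming (C to C₂; X to X₂; polynomialRing to polynomialRing₂)

  K[y₁,y₂] : CommutativeRing (c ⊔ ℓ) ℓ
  K[y₁,y₂] = polynomialRing₂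

  y₁ y₂ : CommutativeRing.Carrier K[y₁,y₂]
  y₁ = C₂ X
  y₂ = X₂

  -- Substitution of u ∈ K[y₁,y₂] for x in f ∈ K[x].
  infix 9 _⟨_⟩
  _⟨_⟩ : Polynomial → CommutativeRing.Carrier K[y₁,y₂] → CommutativeRing.Carrier K[y₁,y₂]
  _⟨_⟩ = Polynomials.Evaluation.eval K K[y₁,y₂] (λ a → C₂ (C a))

  module BivariateNotation where
    open CommutativeRing K[y₁,y₂] using (_≈_; _*_; 1#; semiring) public
    open import Algebra.Properties.Semiring.Exp semiring using (_^_) public
    open import Algebra.Properties.Semiring.Mult semiring using (_×_) public
    open import Algebra.Properties.Semiring.Sum semiring using (sum⁺-syntax) public

{-# OPTIONS --safe #-}

-- Let F_η(x, t) be the generating function of the B_{n,χ,η}(x). The two sides are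
-- n! times the coefficients of tⁿ in F₁(w₂y₁, w₁t) F₂(w₁y₂, w₂t) and
-- F₂(w₁y₁, w₂t) F₁(w₂y₂, w₁t), where Fᵢ belongs to η = ξ^wᵢ. The exponential in
-- Fᵢ at w_{3-i} y and wᵢ t is e^(w₁w₂yt) for both i, and nothing else in it depends
-- on y, so after clearing denominators both products are equal.
-- The denominators D = η^d e^(dwt) - 1 can be cancelled because their t-coefficient
-- η^d dw is invertible. Their constant term η^d - 1 may vanish, as r need not be the
-- order of ξ; since equality in ℂₚ is stable under double negation, one may argue
-- by cases on it.

module Submission where

open import Defs
open import Algebra.Apartness.Bundles using (HeytingField)
import Algebra.Properties.Semiring.Exp as Exp
open import Data.Fin.Base using (toℕ)
open import Data.Nat.Base using (ℕ; NonZero; _∸_) renaming (_*_ to _*ℕ_)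
open import Data.Nat.Combinatorics using (_C_)
open import Data.Nat.Divisibility using (_∣_)
open import Data.Nat.GCD using (gcd)
open import Data.Nat.Primality using (Prime)
import Data.Rational.Properties as ℚ
open import Algebra.Bundles using (CommutativeRing)
open import Relation.Binary.PropositionalEquality using (_≡_)
open import Relation.Nullary using (¬_)

open import Algebra.Bundles.Raw using (module RawRing)
open import Algebra.Morphism.Structures using (module RingMorphisms; module SemiringMorphisms)
import Algebra.Morphism.Construct.Composition as Composition
import Algebra.Properties.CommutativeSemiring.Exp
import Algebra.Properties.Group
import Algebra.Properties.Ring
import Algebra.Properties.Semiring.Mult
import Algebra.Properties.Semiring.Sum
import Algebra.Solver.Ring.NaturalCoefficients.Default
import Data.Fin.Base as Fin
import Data.Fin.Properties as Fin
open import Data.Integer.Base as ℤ using (ℤ; +_)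
import Data.Integer.Properties as ℤ
open import Data.Nat.Base as ℕ using (zero; suc; _!)
open import Data.Nat.Combinatorics using (nCk≡n!/k![n-k]!; k![n∸k]!∣n!)
import Data.Nat.DivMod as ℕ
import Data.Nat.Properties as ℕ
open import Data.Product.Base using (∃-syntax; _,_; proj₁; proj₂)
open import Data.Rational.Base as ℚ using (ℚ; 1ℚ; _/_)
open import Data.Rational.Unnormalised.Base as ℚᵘ using (mkℚᵘ; *≡*)
import Data.Rational.Unnormalised.Properties as ℚᵘ
open import Function.Base using (_∘_)
open import Level using (Level; _⊔_)
import Relation.Binary.PropositionalEquality as ≡
import Relation.Binary.Reasoning.Setoid

private variable
  a b c ℓ ℓ₁ ℓ₂ ℓ₃ : Level

-- Homomorphisms of commutative rings.

-- Semiring homomorphisms suffice: compatibility with negation follows from uniqueness of additive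
-- inverses.
IsHom : (R : CommutativeRing a ℓ₁) (S : CommutativeRing b ℓ₂) →
        (CommutativeRing.Carrier R → CommutativeRing.Carrier S) → Set (a ⊔ ℓ₁ ⊔ ℓ₂)
IsHom R S = SemiringMorphisms.IsSemiringHomomorphism
  (RawRing.rawSemiring (CommutativeRing.rawRing R)) (RawRing.rawSemiring (CommutativeRing.rawRing S))

module _ (R : CommutativeRing a ℓ₁) (S : CommutativeRing b ℓ₂)
         {f : CommutativeRing.Carrier R → CommutativeRing.Carrier S} where
  private
    module R = CommutativeRing R
    module S = CommutativeRing S

  mkIsHom : (∀ {x y} → x R.≈ y → f x S.≈ f y) →
            (∀ x y → f (x R.+ y) S.≈ f x S.+ f y) → f R.0# S.≈ S.0# →
            (∀ x y → f (x R.* y) S.≈ f x S.* f y) → f R.1# S.≈ S.1# →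
            IsHom R S f
  mkIsHom cong +-homo 0-homo *-homo 1-homo = record
    { isNearSemiringHomomorphism = record
      { +-isMonoidHomomorphism = record
        { isMagmaHomomorphism = record
          { isRelHomomorphism = record { cong = cong }
          ; homo = +-homo
          }
        ; ε-homo = 0-homo
        }
      ; *-homo = *-homo
      }
    ; 1#-homo = 1-homo
    }

module HomProperties (R : CommutativeRing a ℓ₁) (S : CommutativeRing b ℓ₂)
                     {f : CommutativeRing.Carrier R → CommutativeRing.Carrier S}
                     (isHom : IsHom R S f) where
  private
    module R = CommutativeRing R
    module S = CommutativeRing S
  open import Algebra.Properties.Semiring.Exp R.semiring using (_^_)
  open import Algebra.Properties.Semiring.Exp S.semiring using () renaming (_^_ to _^ˢ_)
  open import Algebra.Properties.Semiring.Mult R.semiring using (_×_)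
  open import Algebra.Properties.Semiring.Mult S.semiring using () renaming (_×_ to _×ˢ_)
  open import Algebra.Properties.Semiring.Sum R.semiring using (sum)
  open import Algebra.Properties.Semiring.Sum S.semiring using () renaming (sum to sumˢ; sum-cong-≋ to sumˢ-cong)
  open import Algebra.Properties.Group S.+-group using (inverseˡ-unique)

  open SemiringMorphisms.IsSemiringHomomorphism isHom public
    using (⟦⟧-cong; +-homo; 0#-homo; *-homo; 1#-homo)

  unit-homo : ∀ {x x⁻¹} → x⁻¹ R.* x R.≈ R.1# → f x⁻¹ S.* f x S.≈ S.1#
  unit-homo x⁻¹x≈1 = S.trans (S.sym (*-homo _ _)) (S.trans (⟦⟧-cong x⁻¹x≈1) 1#-homo)

  -‿homo : ∀ x → f (R.- x) S.≈ S.- f x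
  -‿homo x = inverseˡ-unique _ _
    (S.trans (S.sym (+-homo _ _)) (S.trans (⟦⟧-cong (R.-‿inverseˡ x)) 0#-homo))

  *-homo-cong : ∀ {x y x′ y′} → f x S.≈ x′ → f y S.≈ y′ → f (x R.* y) S.≈ x′ S.* y′
  *-homo-cong fx≈ fy≈ = S.trans (*-homo _ _) (S.*-cong fx≈ fy≈)

  ^-homo : ∀ x n → f (x ^ n) S.≈ f x ^ˢ n
  ^-homo x zero    = 1#-homo
  ^-homo x (suc n) = S.trans (*-homo _ _) (S.*-congˡ (^-homo x n))

  ×1-homo : ∀ n → f (n × R.1#) S.≈ n ×ˢ S.1#
  ×1-homo zero    = 0#-homo
  ×1-homo (suc n) = S.trans (+-homo _ _) (S.+-cong 1#-homo (×1-homo n))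

  sum-homo : ∀ {n} (xs : _ → R.Carrier) → f (sum {n} xs) S.≈ sumˢ {n} (f ∘ xs)
  sum-homo {zero}  xs = 0#-homo
  sum-homo {suc n} xs = S.trans (+-homo _ _) (S.+-congˡ (sum-homo (xs ∘ Fin.suc)))

  -- The equation has the shape of `IsTwistedBernoulli` with abstract ring elements as factors, so
  -- the image of each factor can be simplified separately.
  equation-homo : ∀ p q b t x {d} (k l m : Fin.Fin d → R.Carrier) →
    (p R.* q R.- R.1#) R.* b R.≈ t R.* x R.* sum {d} (λ i → k i R.* l i R.* m i) →
    ∀ {p′ q′ t′ x′} {k′ l′ m′ : Fin.Fin d → S.Carrier} → f p S.≈ p′ → f q S.≈ q′ → f t S.≈ t′ → f x S.≈ x′ →
    (∀ i → f (k i) S.≈ k′ i) → (∀ i → f (l i) S.≈ l′ i) → (∀ i → f (m i) S.≈ m′ i) →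
    (p′ S.* q′ S.- S.1#) S.* f b S.≈ t′ S.* x′ S.* sumˢ {d} (λ i → k′ i S.* l′ i S.* m′ i)
  equation-homo p q b t x {d} k l m eq fp≈ fq≈ ft≈ fx≈ fk≈ fl≈ fm≈ = S.trans
    (S.sym (S.trans (*-homo _ _) (S.*-congʳ (S.trans (+-homo _ _)
      (S.+-cong (*-homo-cong fp≈ fq≈) (S.trans (-‿homo _) (S.-‿cong 1#-homo)))))))
    (S.trans (⟦⟧-cong eq) (*-homo-cong (*-homo-cong ft≈ fx≈)
      (S.trans (sum-homo {d} _) (sumˢ-cong {d} (λ i → *-homo-cong (*-homo-cong (fk≈ i) (fl≈ i)) (fm≈ i))))))

∘-isHom : (R : CommutativeRing a ℓ₁) (S : CommutativeRing b ℓ₂) (T : CommutativeRing c ℓ₃)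
          {f : CommutativeRing.Carrier R → CommutativeRing.Carrier S}
          {g : CommutativeRing.Carrier S → CommutativeRing.Carrier T} →
          IsHom R S f → IsHom S T g → IsHom R T (g ∘ f)
∘-isHom R S T = Composition.isSemiringHomomorphism (CommutativeRing.trans T)

constant-isHom : (R : CommutativeRing a ℓ) →
                 IsHom R (PowerSeries.powerSeriesRing R) (PowerSeries.constant R)
constant-isHom R = mkIsHom R powerSeriesRing
  (λ { x≈y zero → x≈y ; x≈y (suc n) → refl })
  (λ { x y zero → refl ; x y (suc n) → sym (+-identityˡ 0#) })
  (λ { zero → refl ; (suc n) → refl })
  (λ { x y zero → sym (+-identityʳ _)
     ; x y (suc n) → sym (trans (+-cong (zeroʳ x) (zeroˢ y n)) (+-identityˡ 0#)) })
  (λ _ → refl)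
  where
  open CommutativeRing R
  open PowerSeries R
  zeroˢ : ∀ y → (λ _ → 0#) *ˢ constant y ≈ˢ λ _ → 0#
  zeroˢ y = CommutativeRing.zeroˡ powerSeriesRing (constant y)

-- Equality and operations of polynomials are those of their coefficient series, so the proofs for
-- `constant` carry over unchanged.
C-isHom : (R : CommutativeRing a ℓ) → IsHom R (Polynomials.polynomialRing R) (Polynomials.C R)
C-isHom R = mkIsHom R (Polynomials.polynomialRing R)
  ⟦⟧-cong +-homo 0#-homo *-homo 1#-homo
  where open HomProperties R (PowerSeries.powerSeriesRing R) (constant-isHom R)

-- Evaluation of polynomials as a ring homomorphism.

module EvaluationProperties (R : CommutativeRing a ℓ₁) (S : CommutativeRing b ℓ₂)
                            {φ : CommutativeRing.Carrier R → CommutativeRing.Carrier S}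
                            (φ-isHom : IsHom R S φ) (s : CommutativeRing.Carrier S) where
  private
    module R = CommutativeRing R
    module S = CommutativeRing S
    module φ = HomProperties R S φ-isHom
  open PowerSeries R
  open Polynomials R
  open Polynomial
  open Evaluation S φ
  open import Algebra.Properties.Semiring.Exp S.semiring using (_^_)
  open import Algebra.Properties.Semiring.Sum S.semiring
  open import Algebra.Solver.Ring.NaturalCoefficients.Default S.commutativeSemiring
    using (solve; _:=_; _:+_; _:*_)
  open import Relation.Binary.Reasoning.Setoid S.setoid

  -- `eval` sums up to `bound`, which may differ between equal polynomials. Truncating at an
  -- arbitrary length allows two polynomials to be compared at a common length.
  partialSum : ℕ → Series → S.Carrier
  partialSum n f = ∑[ i < n ] (φ (f (toℕ i)) S.* s ^ toℕ i)

  VanishesFrom : ℕ → Series → Set ℓ₁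
  VanishesFrom n f = ∀ i → n ℕ.≤ i → f i R.≈ R.0#

  vanishes-suc : ∀ {n f} → VanishesFrom (suc n) f → VanishesFrom n (f ∘ suc)
  vanishes-suc v i n≤i = v (suc i) (ℕ.s≤s n≤i)

  partialSum-cong : ∀ n {f g} → f ≈ˢ g → partialSum n f S.≈ partialSum n g
  partialSum-cong n f≈g = sum-cong-≋ {n} (λ i → S.*-congʳ (φ.⟦⟧-cong (f≈g (toℕ i))))

  partialSum-0 : ∀ n {f} → f ≈ˢ (λ _ → R.0#) → partialSum n f S.≈ S.0#
  partialSum-0 n f≈0 = S.trans
    (sum-cong-≋ {n} (λ i → S.trans (S.*-congʳ (S.trans (φ.⟦⟧-cong (f≈0 (toℕ i))) φ.0#-homo)) (S.zeroˡ _)))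
    (sum-replicate-zero n)

  -- Horner's rule, which drives the inductions on the length of truncation.
  partialSum-suc : ∀ n f → partialSum (suc n) f S.≈ φ (f 0) S.+ s S.* partialSum n (f ∘ suc)
  partialSum-suc n f = S.+-cong (S.*-identityʳ _) (S.trans
    (sum-cong-≋ {n} (λ i → solve 3 (λ x y z → x :* (y :* z) := y :* (x :* z)) S.refl (φ (f (suc (toℕ i)))) s (s ^ toℕ i)))
    (S.sym (*-distribˡ-sum {n} s (λ i → φ (f (suc (toℕ i))) S.* s ^ toℕ i))))

  partialSum-≤ : ∀ {m n f} → m ℕ.≤ n → VanishesFrom m f → partialSum n f S.≈ partialSum m f
  partialSum-≤ {n = n} ℕ.z≤n v = partialSum-0 n (λ i → v i ℕ.z≤n)
  partialSum-≤ {suc m} {suc n} {f} (ℕ.s≤s m≤n) v =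
    S.trans (partialSum-suc n f)
      (S.trans (S.+-congˡ (S.*-congˡ (partialSum-≤ m≤n (vanishes-suc v))))
        (S.sym (partialSum-suc m f)))

  partialSum-+ : ∀ n f g → partialSum n (f +ˢ g) S.≈ partialSum n f S.+ partialSum n g
  partialSum-+ n f g = S.trans
    (sum-cong-≋ {n} (λ i → S.trans (S.*-congʳ (φ.+-homo _ _)) (S.distribʳ _ _ _)))
    (∑-distrib-+ {n} (λ i → φ (f (toℕ i)) S.* s ^ toℕ i) (λ i → φ (g (toℕ i)) S.* s ^ toℕ i))

  partialSum-scale : ∀ n x f → partialSum n (λ i → x R.* f i) S.≈ φ x S.* partialSum n f
  partialSum-scale n x f = S.trans
    (sum-cong-≋ {n} (λ i → S.trans (S.*-congʳ (φ.*-homo _ _)) (S.*-assoc _ _ _)))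
    (S.sym (*-distribˡ-sum {n} (φ x) (λ i → φ (f (toℕ i)) S.* s ^ toℕ i)))

  -- Induction on `m`: by definition the shifted series `(f *ˢ g) ∘ suc` is `f 0` times the shift of
  -- `g` plus `(f ∘ suc) *ˢ g`, and `f ∘ suc` vanishes one index earlier than `f`.
  partialSum-* : ∀ m n f g → VanishesFrom m f → VanishesFrom n g →
                 partialSum (m ℕ.+ n) (f *ˢ g) S.≈ partialSum m f S.* partialSum n g
  partialSum-* zero n f g vf vg = S.trans
    (partialSum-0 n (λ i → R.trans
      (*ˢ-cong {g = g} (λ k → vf k ℕ.z≤n) (λ _ → R.refl) i)
      (CommutativeRing.zeroˡ powerSeriesRing g i)))
    (S.sym (S.zeroˡ _))
  partialSum-* (suc m) n f g vf vg = begin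
    partialSum (suc (m ℕ.+ n)) (f *ˢ g)
      ≈⟨ partialSum-suc (m ℕ.+ n) (f *ˢ g) ⟩
    φ (f 0 R.* g 0 R.+ R.0#) S.+ s S.* partialSum (m ℕ.+ n) ((λ i → f 0 R.* g (suc i)) +ˢ (f ∘ suc) *ˢ g)
      ≈⟨ S.+-cong (S.trans (φ.⟦⟧-cong (R.+-identityʳ _)) (φ.*-homo _ _))
           (S.*-congˡ (S.trans (partialSum-+ (m ℕ.+ n) (λ i → f 0 R.* g (suc i)) ((f ∘ suc) *ˢ g))
             (S.+-cong (partialSum-scale (m ℕ.+ n) (f 0) (g ∘ suc))
                       (partialSum-* m n (f ∘ suc) g (vanishes-suc vf) vg)))) ⟩
    φ (f 0) S.* φ (g 0) S.+ s S.* (φ (f 0) S.* partialSum (m ℕ.+ n) (g ∘ suc) S.+ F S.* G)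
      ≈⟨ solve 6 (λ x y s p F G → x :* y :+ s :* (x :* p :+ F :* G) := x :* (y :+ s :* p) :+ s :* F :* G)
           S.refl (φ (f 0)) (φ (g 0)) s (partialSum (m ℕ.+ n) (g ∘ suc)) F G ⟩
    φ (f 0) S.* (φ (g 0) S.+ s S.* partialSum (m ℕ.+ n) (g ∘ suc)) S.+ s S.* F S.* G
      -- Horner's rule read backwards gives a sum of length `suc (m + n)`, which shortens to `n`
      -- because `g` vanishes from there on.
      ≈⟨ S.+-congʳ (S.*-congˡ (S.trans (S.sym (partialSum-suc (m ℕ.+ n) g))
           (partialSum-≤ (ℕ.m≤n+m n (suc m)) vg))) ⟩
    φ (f 0) S.* G S.+ s S.* F S.* G
      ≈⟨ S.distribʳ _ _ _ ⟨
    (φ (f 0) S.+ s S.* F) S.* G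
      ≈⟨ S.*-congʳ (partialSum-suc m f) ⟨
    partialSum (suc m) f S.* G ∎
    where
    F = partialSum m (f ∘ suc)
    G = partialSum n g

  eval≈partialSum : ∀ p {n} → bound p ℕ.≤ n → eval p s S.≈ partialSum n (coefficient p)
  eval≈partialSum p b≤n = S.sym (partialSum-≤ b≤n (vanishes p))

  eval-cong : ∀ {p q} → p ≈ᵖ q → eval p s S.≈ eval q s
  eval-cong {p} {q} p≈q = S.trans (eval≈partialSum p (ℕ.m≤m⊔n (bound p) (bound q)))
    (S.trans (partialSum-cong (bound p ℕ.⊔ bound q) p≈q)
      (S.sym (eval≈partialSum q (ℕ.m≤n⊔m (bound p) (bound q)))))

  eval-+ : ∀ p q → eval (p +ᵖ q) s S.≈ eval p s S.+ eval q s
  eval-+ p q = S.trans (partialSum-+ (bound p ℕ.⊔ bound q) (coefficient p) (coefficient q))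
    (S.sym (S.+-cong (eval≈partialSum p (ℕ.m≤m⊔n (bound p) (bound q)))
                     (eval≈partialSum q (ℕ.m≤n⊔m (bound p) (bound q)))))

  eval-C : ∀ x → eval (C x) s S.≈ φ x
  eval-C x = S.trans (S.+-identityʳ _) (S.*-identityʳ _)

  eval-X : eval X s S.≈ s
  eval-X = begin
    φ R.0# S.* S.1# S.+ (φ R.1# S.* (s S.* S.1#) S.+ S.0#)
      ≈⟨ S.+-cong (S.trans (S.*-congʳ φ.0#-homo) (S.zeroˡ _))
           (S.trans (S.+-identityʳ _) (S.*-cong φ.1#-homo (S.*-identityʳ s))) ⟩
    S.0# S.+ S.1# S.* s
      ≈⟨ S.trans (S.+-identityˡ _) (S.*-identityˡ s) ⟩
    s ∎

  eval-isHom : IsHom polynomialRing S (λ p → eval p s)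
  eval-isHom = mkIsHom polynomialRing S
    (λ {p} {q} → eval-cong {p} {q}) eval-+ S.refl
    (λ p q → partialSum-* (bound p) (bound q) (coefficient p) (coefficient q) (vanishes p) (vanishes q))
    (S.trans (eval-C R.1#) φ.1#-homo)

-- Equality and units in Heyting fields.

Stable≈ : CommutativeRing a ℓ → Set _
Stable≈ R = ∀ x y → ¬ ¬ x ≈ y → x ≈ y
  where open CommutativeRing R

-- Tightness makes equality the negation of apartness, and negations are stable.
HeytingField-stable≈ : (K : HeytingField a ℓ₁ ℓ₂) → Stable≈ (ringOf K)
HeytingField-stable≈ K x y ¬¬x≈y = proj₁ (tight x y) λ x#y →
  ¬¬x≈y λ x≈y → proj₂ (tight x y) x≈y x#y
  where open HeytingField K

-- A substitute for deciding whether a field element is zero. Polynomial rings over a field lack the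
-- property, the variable being neither zero nor a unit, so it is applied only to elements coming
-- from `K`.
¬Unit⇒≈0 : CommutativeRing a ℓ → Set _
¬Unit⇒≈0 R = ∀ x → ¬ (∃[ x⁻¹ ] x⁻¹ * x ≈ 1#) → x ≈ 0#
  where open CommutativeRing R

-- An element apart from zero is invertible, so a non-unit is not apart from zero, and tightness
-- applies.
HeytingField-¬Unit⇒≈0 : (K : HeytingField a ℓ₁ ℓ₂) → ¬Unit⇒≈0 (ringOf K)
HeytingField-¬Unit⇒≈0 K x ¬unit = proj₁ (tight x 0#) λ x#0 →
  let y , y[x-0]≈1 , _ = #⇒invertible x#0 in
  ¬unit (y , trans (*-congˡ (sym (x-0≈x x))) y[x-0]≈1)
  where
  open HeytingField K
  open import Algebra.Apartness.Properties.HeytingCommutativeRing heytingCommutativeRing using (x-0≈x)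

-- Cancellation in power series rings.

module SeriesProperties (R : CommutativeRing a ℓ) where
  open CommutativeRing R
  open PowerSeries R
  open import Algebra.Properties.Group +-group using (x∙y⁻¹≈ε⇒x≈y)
  open import Algebra.Solver.Ring.NaturalCoefficients.Default commutativeSemiring
    using (solve; _:=_; _:*_)
  open import Relation.Binary.Reasoning.Setoid setoid
  private module S = CommutativeRing powerSeriesRing

  0ˢ : Series
  0ˢ _ = 0#

  constant-* : ∀ x f → constant x *ˢ f ≈ˢ λ n → x * f n
  constant-* x f zero    = +-identityʳ _
  constant-* x f (suc n) = trans (+-congˡ (S.zeroˡ f n)) (+-identityʳ _)

  -- The constant term of the product forces `f 0` to vanish; then `f ∘ suc` satisfies the same
  -- hypothesis, and the coefficients of `f` vanish one after another.
  unit⇒cancelʳ : ∀ {e} f g → e * g 0 ≈ 1# → f *ˢ g ≈ˢ 0ˢ → f ≈ˢ 0ˢ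
  unit⇒cancelʳ {e} f g eg₀≈1 fg≈0 = λ { zero → f₀≈0 ; (suc n) → unit⇒cancelʳ (f ∘ suc) g eg₀≈1 tail≈0 n }
    where
    f₀≈0 : f 0 ≈ 0#
    f₀≈0 = begin
      f 0                        ≈⟨ *-identityʳ _ ⟨
      f 0 * 1#                   ≈⟨ *-congˡ eg₀≈1 ⟨
      f 0 * (e * g 0)            ≈⟨ solve 3 (λ x e y → x :* (e :* y) := e :* (x :* y)) refl (f 0) e (g 0) ⟩
      e * (f 0 * g 0)            ≈⟨ *-congˡ (trans (sym (+-identityʳ _)) (fg≈0 0)) ⟩
      e * 0#                     ≈⟨ zeroʳ e ⟩
      0#                         ∎
    tail≈0 : (f ∘ suc) *ˢ g ≈ˢ 0ˢ
    tail≈0 n = begin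
      ((f ∘ suc) *ˢ g) n                      ≈⟨ +-identityˡ _ ⟨
      0# + ((f ∘ suc) *ˢ g) n                 ≈⟨ +-congʳ (trans (*-congʳ f₀≈0) (zeroˡ _)) ⟨
      f 0 * g (suc n) + ((f ∘ suc) *ˢ g) n    ≈⟨ fg≈0 (suc n) ⟩
      0#                                      ∎

  -- With zero constant term, `g` is the variable times `g ∘ suc`, and multiplication by the
  -- variable only shifts coefficients.
  zero⇒cancelʳ : ∀ f g → g 0 ≈ 0# → f *ˢ g ≈ˢ 0ˢ → f *ˢ (g ∘ suc) ≈ˢ 0ˢ
  zero⇒cancelʳ f g g₀≈0 fg≈0 n = begin
    (f *ˢ (g ∘ suc)) n                       ≈⟨ +-identityˡ _ ⟨
    0# + (f *ˢ (g ∘ suc)) n                  ≈⟨ +-congʳ (trans (*-congˡ g₀≈0) (zeroʳ _)) ⟨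
    f (suc n) * g 0 + (f *ˢ (g ∘ suc)) n     ≈⟨ *ˢ-last f g n ⟨
    (f *ˢ g) (suc n)                         ≈⟨ fg≈0 (suc n) ⟩
    0#                                       ∎

  -- Whether the constant term of h is 0 or a unit is undecidable, but stability
  -- of ≈ on R allows the case distinction.
  module _ (K : CommutativeRing b ℓ₁) (¬unit⇒≈0 : ¬Unit⇒≈0 K)
           {j : CommutativeRing.Carrier K → Carrier} (j-isHom : IsHom K R j)
           (stable : Stable≈ R) where
    private
      module K = CommutativeRing K
      module j = HomProperties K R j-isHom

    *ˢ-cancelʳ-zero : ∀ {x e} f h → h 0 ≈ j x → e * h 1 ≈ 1# → f *ˢ h ≈ˢ 0ˢ → f ≈ˢ 0ˢ
    *ˢ-cancelʳ-zero {x} {e} f h h₀≈jx eh₁≈1 fh≈0 n = stable _ _ λ fₙ≉0 →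
      -- A unit constant term would already give `f n ≈ 0`, so `x` is not a unit.
      let x≈0 = ¬unit⇒≈0 x λ (y , yx≈1) → fₙ≉0 (unit⇒cancelʳ f h
                  (trans (*-congˡ h₀≈jx) (j.unit-homo yx≈1)) fh≈0 n)
      -- Once the factor `t` is removed from `h`, its new constant term is `h 1`, with inverse `e`.
      in fₙ≉0 (unit⇒cancelʳ f (h ∘ suc) eh₁≈1
                (zero⇒cancelʳ f h (trans h₀≈jx (trans (j.⟦⟧-cong x≈0) j.0#-homo)) fh≈0) n)

    *ˢ-cancelˡ : ∀ {x e} h f g → h 0 ≈ j x → e * h 1 ≈ 1# → h *ˢ f ≈ˢ h *ˢ g → f ≈ˢ g
    *ˢ-cancelˡ h f g h₀≈jx eh₁≈1 hf≈hg n = x∙y⁻¹≈ε⇒x≈y _ _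
      (*ˢ-cancelʳ-zero (f S.- g) h h₀≈jx eh₁≈1 [f-g]h≈0 n)
      where
      open Algebra.Properties.Ring S.ring using ([y-z]x≈yx-zx)
      [f-g]h≈0 : (f S.- g) *ˢ h ≈ˢ 0ˢ
      [f-g]h≈0 = S.trans ([y-z]x≈yx-zx h f g)
        (S.trans (S.+-congʳ (S.trans (S.*-comm f h) (S.trans hf≈hg (S.*-comm h g))))
          (S.-‿inverseʳ (g *ˢ h)))

-- The substitution of `w t` for `t`.

module Rescaling (P : CommutativeRing a ℓ₁) (A : CommutativeRing b ℓ₂)
                 {φ : CommutativeRing.Carrier P → CommutativeRing.Carrier A}
                 (φ-isHom : IsHom P A φ) (w : CommutativeRing.Carrier A) where
  private
    module P = CommutativeRing P
    module P⟦t⟧ = PowerSeries P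
    module φ = HomProperties P A φ-isHom
  open CommutativeRing A
  open PowerSeries A
  open SeriesProperties A
  open import Algebra.Properties.Semiring.Exp semiring
  open import Algebra.Properties.Semiring.Sum semiring
  open import Algebra.Solver.Ring.NaturalCoefficients.Default commutativeSemiring
    using (solve; _:=_; _:*_)
  open import Relation.Binary.Reasoning.Setoid setoid

  -- Sends `f(t)` to `(φ f)(w t)`. Being a ring homomorphism, it transports the defining identity of
  -- the Bernoulli polynomials to `A`.
  rescale : P⟦t⟧.Series → Series
  rescale f n = φ (f n) * w ^ n

  rescale-* : ∀ f g → rescale (f P⟦t⟧.*ˢ g) ≈ˢ rescale f *ˢ rescale g
  rescale-* f g n = begin
    φ ((f P⟦t⟧.*ˢ g) n) * w ^ n
      ≈⟨ *-congʳ (φ.sum-homo {suc n} (λ i → f (toℕ i) P.* g (n ∸ toℕ i))) ⟩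
    ∑[ i ≤ n ] φ (f (toℕ i) P.* g (n ∸ toℕ i)) * w ^ n
      ≈⟨ *-distribʳ-sum {suc n} (w ^ n) (λ i → φ (f (toℕ i) P.* g (n ∸ toℕ i))) ⟩
    ∑[ i ≤ n ] (φ (f (toℕ i) P.* g (n ∸ toℕ i)) * w ^ n)
      ≈⟨ sum-cong-≋ {suc n} (λ i → term (Fin.toℕ≤pred[n] i)) ⟩
    (rescale f *ˢ rescale g) n ∎
    where
    term : ∀ {i} → i ℕ.≤ n → φ (f i P.* g (n ∸ i)) * w ^ n ≈ rescale f i * rescale g (n ∸ i)
    term {i} i≤n = begin
      φ (f i P.* g (n ∸ i)) * w ^ n
        ≈⟨ *-cong (φ.*-homo _ _) (^-congʳ w (≡.sym (ℕ.m+[n∸m]≡n i≤n))) ⟩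
      φ (f i) * φ (g (n ∸ i)) * w ^ (i ℕ.+ (n ∸ i))
        ≈⟨ *-congˡ (^-homo-* w i (n ∸ i)) ⟩
      φ (f i) * φ (g (n ∸ i)) * (w ^ i * w ^ (n ∸ i))
        ≈⟨ solve 4 (λ x y u v → x :* y :* (u :* v) := x :* u :* (y :* v)) refl
             (φ (f i)) (φ (g (n ∸ i))) (w ^ i) (w ^ (n ∸ i)) ⟩
      rescale f i * rescale g (n ∸ i) ∎

  rescale-constant : ∀ x → rescale (P⟦t⟧.constant x) ≈ˢ constant (φ x)
  rescale-constant x zero    = *-identityʳ _
  rescale-constant x (suc n) = trans (*-congʳ φ.0#-homo) (zeroˡ _)

  rescale-indeterminate : rescale P⟦t⟧.indeterminate ≈ˢ constant w *ˢ indeterminate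
  rescale-indeterminate zero = trans (trans (*-congʳ φ.0#-homo) (zeroˡ _))
    (sym (trans (constant-* w indeterminate 0) (zeroʳ w)))
  rescale-indeterminate (suc zero) = trans (*-cong φ.1#-homo (*-identityʳ w))
    (trans (*-comm _ _) (sym (constant-* w indeterminate 1)))
  rescale-indeterminate (suc (suc n)) = trans (trans (*-congʳ φ.0#-homo) (zeroˡ _))
    (sym (trans (constant-* w indeterminate (suc (suc n))) (zeroʳ w)))

  rescale-isHom : IsHom P⟦t⟧.powerSeriesRing powerSeriesRing rescale
  rescale-isHom = mkIsHom P⟦t⟧.powerSeriesRing powerSeriesRing
    (λ f≈g n → *-congʳ (φ.⟦⟧-cong (f≈g n)))
    (λ f g n → trans (*-congʳ (φ.+-homo _ _)) (distribʳ _ _ _))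
    (λ n → trans (*-congʳ φ.0#-homo) (zeroˡ _))
    rescale-*
    (λ n → trans (rescale-constant P.1# n) (HomProperties.⟦⟧-cong A powerSeriesRing (constant-isHom A) φ.1#-homo n))

-- Units and rearrangements in commutative rings.

module _ (R : CommutativeRing a ℓ) where
  open CommutativeRing R
  open Algebra.Properties.CommutativeSemiring.Exp commutativeSemiring
  open Algebra.Properties.Semiring.Mult semiring
  open Algebra.Solver.Ring.NaturalCoefficients.Default commutativeSemiring
    using (solve; _:=_; _:*_)

  unit-* : ∀ {x y x⁻¹ y⁻¹} → x⁻¹ * x ≈ 1# → y⁻¹ * y ≈ 1# → (x⁻¹ * y⁻¹) * (x * y) ≈ 1#
  unit-* {x} {y} {x⁻¹} {y⁻¹} x⁻¹x≈1 y⁻¹y≈1 = trans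
    (solve 4 (λ p q r s → (p :* q) :* (r :* s) := (p :* r) :* (q :* s)) refl x⁻¹ y⁻¹ x y)
    (trans (*-cong x⁻¹x≈1 y⁻¹y≈1) (*-identityˡ 1#))

  unit-^ : ∀ {x x⁻¹} n → x⁻¹ * x ≈ 1# → x⁻¹ ^ n * x ^ n ≈ 1#
  unit-^ zero    _      = *-identityˡ 1#
  unit-^ (suc n) x⁻¹x≈1 = unit-* x⁻¹x≈1 (unit-^ n x⁻¹x≈1)

  rootOfUnity-unit : ∀ {x} r .{{_ : NonZero r}} → x ^ r ≈ 1# → ∃[ x⁻¹ ] x⁻¹ * x ≈ 1#
  -- Here `r` is the predecessor of the exponent, so the inverse is one power below it.
  rootOfUnity-unit {x} (suc r) xʳ≈1 = x ^ r , trans (*-comm _ _) xʳ≈1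

  -- Both sides are `m n x`. This identifies the exponents in which `w₁` and `w₂` are swapped.
  ×-*-×1-comm : ∀ m n x → m × x * (n × 1#) ≈ n × x * (m × 1#)
  ×-*-×1-comm m n x = trans (×-multiply m n)
    (trans (×-congˡ (ℕ.*-comm n m)) (sym (×-multiply n m)))
    where
    ×-multiply : ∀ m n → m × x * (n × 1#) ≈ (n *ℕ m) × x
    ×-multiply m n = trans (×-comm-* n (m × x) 1#)
      (trans (×-congʳ n (*-identityʳ _)) (×-assocˡ x n m))

  -- `D` stands for denominators, `L` for generating functions, `e` and `f` for exponentials and `s`
  -- for character sums. The exponentials trade places between the indices 1 and 2, and the other
  -- factors stay with their denominators.
  exchange-factors : ∀ {D₁ D₂ L₁ L₂ L₃ L₄ t₁ t₂ e e′ f f′ s₁ s₂} → e ≈ e′ → f ≈ f′ →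
    D₁ * L₁ ≈ t₁ * e * s₁ → D₂ * L₂ ≈ t₂ * f * s₂ →
    D₂ * L₃ ≈ t₂ * e′ * s₂ → D₁ * L₄ ≈ t₁ * f′ * s₁ →
    D₁ * (D₂ * (L₁ * L₂)) ≈ D₁ * (D₂ * (L₃ * L₄))
  exchange-factors {D₁} {D₂} {L₁} {L₂} {L₃} {L₄} {t₁} {t₂} {e} {e′} {f} {f′} {s₁} {s₂} e≈e′ f≈f′ eq₁ eq₂ eq₃ eq₄ = begin
    D₁ * (D₂ * (L₁ * L₂))
      ≈⟨ solve 4 (λ p q r s → p :* (q :* (r :* s)) := (p :* r) :* (q :* s)) refl D₁ D₂ L₁ L₂ ⟩
    (D₁ * L₁) * (D₂ * L₂)
      ≈⟨ *-cong (trans eq₁ (*-congʳ (*-congˡ e≈e′))) (trans eq₂ (*-congʳ (*-congˡ f≈f′))) ⟩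
    (t₁ * e′ * s₁) * (t₂ * f′ * s₂)
      ≈⟨ solve 6 (λ t₁ t₂ e f s₁ s₂ → (t₁ :* e :* s₁) :* (t₂ :* f :* s₂) := (t₂ :* e :* s₂) :* (t₁ :* f :* s₁))
           refl t₁ t₂ e′ f′ s₁ s₂ ⟩
    (t₂ * e′ * s₂) * (t₁ * f′ * s₁)
      ≈⟨ *-cong eq₃ eq₄ ⟨
    (D₂ * L₃) * (D₁ * L₄)
      ≈⟨ solve 4 (λ p q r s → (q :* r) :* (p :* s) := p :* (q :* (r :* s))) refl D₁ D₂ L₃ L₄ ⟩
    D₁ * (D₂ * (L₃ * L₄)) ∎
    where open Relation.Binary.Reasoning.Setoid setoid

-- Inverses of integers in ℚ, and factorials.

ℚ-ring : CommutativeRing _ _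
ℚ-ring = ringOf ℚ.heytingField

module _ where
  open Algebra.Properties.Semiring.Mult (CommutativeRing.semiring ℚ-ring) using (_×_; ×-assoc-*)
  open ℚᵘ.≃-Reasoning

  -- Normalised fractions are reduced by a gcd, so the addition is carried out in the unnormalised
  -- rationals, where equality is cross-multiplication.
  ×-1/ : ∀ n m .{{_ : NonZero m}} → n × (+ 1 / m) ≡ + n / m
  ×-1/ zero    m = ≡.sym (ℚ.0/n≡0 m)
  ×-1/ (suc n) m@(suc m-1) = ≡.trans (≡.cong (+ 1 / m ℚ.+_) (×-1/ n m)) (ℚ.toℚᵘ-injective (begin
    ℚ.toℚᵘ (+ 1 / m ℚ.+ + n / m)
      ≈⟨ ℚ.toℚᵘ-homo-+ (+ 1 / m) (+ n / m) ⟩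
    ℚ.toℚᵘ (+ 1 / m) ℚᵘ.+ ℚ.toℚᵘ (+ n / m)
      ≈⟨ ℚᵘ.+-cong (ℚ.toℚᵘ-fromℚᵘ (mkℚᵘ (+ 1) m-1)) (ℚ.toℚᵘ-fromℚᵘ (mkℚᵘ (+ n) m-1)) ⟩
    mkℚᵘ (+ 1) m-1 ℚᵘ.+ mkℚᵘ (+ n) m-1
      ≈⟨ *≡* (≡.trans (≡.cong (ℤ._* + m) (≡.sym (ℤ.*-distribʳ-+ (+ m) (+ 1) (+ n))))
               (ℤ.*-assoc (+ suc n) (+ m) (+ m))) ⟩
    mkℚᵘ (+ suc n) m-1
      ≈⟨ ℚ.toℚᵘ-fromℚᵘ (mkℚᵘ (+ suc n) m-1) ⟨
    ℚ.toℚᵘ (+ suc n / m) ∎))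

  n/n≡1 : ∀ m .{{_ : NonZero m}} → + m / m ≡ 1ℚ
  n/n≡1 m@(suc m-1) = ℚ.toℚᵘ-injective
    (ℚᵘ.≃-trans (ℚ.toℚᵘ-fromℚᵘ (mkℚᵘ (+ m) m-1)) (*≡* (ℤ.*-comm (+ m) (+ 1))))

  ×1-*-1/ : ∀ m .{{_ : NonZero m}} → (m × 1ℚ) ℚ.* (+ 1 / m) ≡ 1ℚ
  ×1-*-1/ m = ≡.trans (×-assoc-* m 1ℚ (+ 1 / m))
    (≡.trans (≡.cong (m ×_) (ℚ.*-identityˡ (+ 1 / m))) (≡.trans (×-1/ m m) (n/n≡1 m)))

n!≡nCk*k!*[n∸k]! : ∀ {n k} → k ℕ.≤ n → n ! ≡ (n C k) ℕ.* (k ! ℕ.* (n ∸ k) !)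
n!≡nCk*k!*[n∸k]! {n} {k} k≤n = ≡.sym (≡.trans
  (≡.cong (ℕ._* (k ! ℕ.* (n ∸ k) !)) (nCk≡n!/k![n-k]! k≤n))
  (ℕ.m/n*n≡m {{k ℕ.!* (n ∸ k) !≢0}} (k![n∸k]!∣n! k≤n)))

-- A record over the operations occurring in the identity: two notations for it
-- over the same ring are then compared operation by operation, where comparing
-- the polynomials themselves would unfold all of their fields.
record SymmetryIdentity {P : Set a} {A : Set b} (_≈_ : A → A → Set ℓ)
    (_*_ : A → A → A) (1# : A) (_^_ : A → ℕ → A) (_×_ : ℕ → A → A)
    (∑≤ : ∀ n → (Fin.Fin (suc n) → A) → A) (_⟨_⟩ : P → A → A)
    (B₁ B₂ : ℕ → P) (w₁ w₂ : ℕ) (x y : A) (n : ℕ) : Set ℓ where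
  constructor symmetryIdentity
  field
    identity :
      ∑≤ n (λ k → (n C toℕ k) × ((((B₁ (toℕ k) ⟨ w₂ × x ⟩) * (B₂ (n ∸ toℕ k) ⟨ w₁ × y ⟩))
        * ((w₁ × 1#) ^ toℕ k)) * ((w₂ × 1#) ^ (n ∸ toℕ k))))
        ≈
      ∑≤ n (λ k → (n C toℕ k) × ((((B₂ (toℕ k) ⟨ w₁ × x ⟩) * (B₁ (n ∸ toℕ k) ⟨ w₂ × y ⟩))
        * ((w₂ × 1#) ^ toℕ k)) * ((w₁ × 1#) ^ (n ∸ toℕ k))))

-- Generating functions over an arbitrary `K`-algebra `A`, later `K[y₁,y₂]`.

module Specialisation (K : CommutativeRing a ℓ₁) (A : CommutativeRing b ℓ)
    (ι : ℚ → CommutativeRing.Carrier K) (ι-isHom : IsHom ℚ-ring K ι)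
    (j : CommutativeRing.Carrier K → CommutativeRing.Carrier A) (j-isHom : IsHom K A j) where
  private
    module K = CommutativeRing K
    module j = HomProperties K A j-isHom
    ψ-isHom : IsHom ℚ-ring A (j ∘ ι)
    ψ-isHom = ∘-isHom ℚ-ring K A ι-isHom j-isHom
    module ψ = HomProperties ℚ-ring A ψ-isHom
  open CommutativeRing A
  open PowerSeries A using (Series; _≈ˢ_; _*ˢ_; constant; indeterminate; powerSeriesRing)
  open SeriesProperties A
  open Exp semiring
  open Algebra.Properties.CommutativeSemiring.Exp commutativeSemiring using (^-distrib-*)
  open Exp K.semiring using () renaming (_^_ to _^ᴷ_)
  open Algebra.Properties.Semiring.Mult semiring
  open Algebra.Properties.Semiring.Sum semiring
  open Algebra.Solver.Ring.NaturalCoefficients.Default commutativeSemiring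
    using (solve; _:=_; _:*_)
  open Algebra.Properties.Ring ring using (-0#≈0#)
  open Relation.Binary.Reasoning.Setoid setoid
  private
    module S = CommutativeRing powerSeriesRing
    module ΣS = Algebra.Properties.Semiring.Sum S.semiring
    module T = TwistedBernoulli K ι
    module P = CommutativeRing T.polynomialRing
  open Exp P.semiring using () renaming (_^_ to _^ᵖ_)

  1/! : ℕ → Carrier
  1/! n = j (ι ((+ 1 / n !) {{n ℕ.!≢0}}))

  exp : Carrier → Series
  exp v n = 1/! n * v ^ n

  -- Together with `characterSum` and `linear`, a factor of the identity `IsTwistedBernoulli` after
  -- `t` has become `w t`.
  denominator : ℕ → K.Carrier → Carrier → Series
  denominator d η w = constant (j (η ^ᴷ d)) *ˢ exp (d × 1# * w) S.- S.1#

  characterSum : ℕ → (ℤ → K.Carrier) → K.Carrier → Carrier → Series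
  characterSum d χ η w =
    ΣS.sum {d} (λ i → constant (j (χ (+ toℕ i))) *ˢ constant (j (η ^ᴷ toℕ i)) *ˢ exp (toℕ i × 1# * w))

  linear : Carrier → Series
  linear w = constant w *ˢ indeterminate

  exp-cong : ∀ {x y} → x ≈ y → exp x ≈ˢ exp y
  exp-cong x≈y n = *-congˡ (^-congˡ n x≈y)

  -- `A` is a ℚ-algebra through `j ∘ ι`, so the image of `1 / m` is the inverse.
  ×1-unit : ∀ m .{{_ : NonZero m}} → ∃[ e ] e * (m × 1#) ≈ 1#
  ×1-unit m = j (ι (+ 1 / m)) , (begin
    j (ι (+ 1 / m)) * (m × 1#)       ≈⟨ *-comm _ _ ⟩
    m × 1# * j (ι (+ 1 / m))         ≈⟨ *-congʳ (ψ.×1-homo m) ⟨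
    j (ι (m ×ℚ 1ℚ)) * j (ι (+ 1 / m)) ≈⟨ ψ.*-homo _ _ ⟨
    j (ι (m ×ℚ 1ℚ ℚ.* (+ 1 / m)))    ≈⟨ ψ.⟦⟧-cong (×1-*-1/ m) ⟩
    j (ι 1ℚ)                         ≈⟨ ψ.1#-homo ⟩
    1#                               ∎)
    where open Algebra.Properties.Semiring.Mult (CommutativeRing.semiring ℚ-ring) using () renaming (_×_ to _×ℚ_)

  !-*-1/! : ∀ n → (n !) × 1# * 1/! n ≈ 1#
  !-*-1/! n = trans (*-comm _ _) (proj₂ (×1-unit (n !) {{n ℕ.!≢0}}))

  open Polynomials.Evaluation K A j public using (eval)

  module At (u w : Carrier) where
    open EvaluationProperties K A j-isHom u

    φ : T.Polynomial → Carrier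
    φ p = eval p u

    private module φ = HomProperties T.polynomialRing A {φ} eval-isHom
    open Rescaling T.polynomialRing A {φ} eval-isHom w public
    private module R = HomProperties (PowerSeries.powerSeriesRing T.polynomialRing) powerSeriesRing rescale-isHom

    rescale-egf : ∀ B n → rescale (T.egf B) n ≈ 1/! n * (φ (B n) * w ^ n)
    rescale-egf B n = trans (*-congʳ (trans (φ.*-homo (T.C _) (B n)) (*-congʳ (eval-C _)))) (*-assoc _ _ _)

    rescale-exp : ∀ p → rescale (T.exp p) ≈ˢ exp (φ p * w)
    rescale-exp p n = trans (rescale-egf (p ^ᵖ_) n)
      (*-congˡ (trans (*-congʳ (φ.^-homo p n)) (sym (^-distrib-* (φ p) w n))))

    rescale-natural : ∀ m → rescale (T.exp (T.natural m)) ≈ˢ exp (m × 1# * w)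
    rescale-natural m = S.trans (rescale-exp (T.natural m)) (exp-cong (*-congʳ (φ.×1-homo m)))

    rescale-scalar : ∀ x → rescale (T.scalar x) ≈ˢ constant (j x)
    rescale-scalar x = S.trans (rescale-constant (T.C x))
      (HomProperties.⟦⟧-cong A powerSeriesRing (constant-isHom A) (eval-C x))

    -- The defining identity at `x = u` with `w t` for `t`. On the right only `exp (u * w)` depends
    -- on `u`.
    rescale-twistedBernoulli : ∀ d χ η B → T.IsTwistedBernoulli d χ η B →
      denominator d η w *ˢ rescale (T.egf B) ≈ˢ linear w *ˢ exp (u * w) *ˢ characterSum d χ η w
    rescale-twistedBernoulli d χ η B isB = R.equation-homo
      (T.scalar (η ^ᴷ d)) (T.exp (T.natural d)) (T.egf B) (PowerSeries.indeterminate T.polynomialRing) (T.exp T.X) {d}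
      (λ i → T.scalar (χ (+ toℕ i))) (λ i → T.scalar (η ^ᴷ toℕ i)) (λ i → T.exp (T.natural (toℕ i))) isB
      (rescale-scalar (η ^ᴷ d)) (rescale-natural d) rescale-indeterminate
      (S.trans (rescale-exp T.X) (exp-cong (*-congʳ eval-X)))
      (λ i → rescale-scalar (χ (+ toℕ i))) (λ i → rescale-scalar (η ^ᴷ toℕ i)) (λ i → rescale-natural (toℕ i))

  -- Multiplying the Cauchy product by `n!` turns it into a binomial convolution, as `n!` is the
  -- binomial coefficient times `k! (n - k)!`.
  product-coefficient : ∀ x w y v B B′ n →
    (n !) × 1# * (At.rescale x w (T.egf B) *ˢ At.rescale y v (T.egf B′)) n ≈
      ∑[ k ≤ n ] ((n C toℕ k) × (eval (B (toℕ k)) x * eval (B′ (n ∸ toℕ k)) y * w ^ toℕ k * v ^ (n ∸ toℕ k)))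
  product-coefficient x w y v B B′ n = trans
    (*-distribˡ-sum {suc n} ((n !) × 1#) (λ k → At.rescale x w (T.egf B) (toℕ k) * At.rescale y v (T.egf B′) (n ∸ toℕ k)))
    (sum-cong-≋ {suc n} (λ k → term (Fin.toℕ≤pred[n] k)))
    where
    term : ∀ {k} → k ℕ.≤ n →
      (n !) × 1# * (At.rescale x w (T.egf B) k * At.rescale y v (T.egf B′) (n ∸ k)) ≈
        (n C k) × (eval (B k) x * eval (B′ (n ∸ k)) y * w ^ k * v ^ (n ∸ k))
    term {k} k≤n = begin
      (n !) × 1# * (At.rescale x w (T.egf B) k * At.rescale y v (T.egf B′) (n ∸ k))
        ≈⟨ *-cong factorials (*-cong (At.rescale-egf x w B k) (At.rescale-egf y v B′ (n ∸ k))) ⟩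
      e * (p * q) * ((1/! k * (β * w ^ k)) * (1/! (n ∸ k) * (β′ * v ^ (n ∸ k))))
        -- Each factorial is moved next to its inverse.
        ≈⟨ solve 9 (λ e p q r s β β′ t u → e :* (p :* q) :* ((r :* (β :* t)) :* (s :* (β′ :* u)))
                     := (p :* r) :* (q :* s) :* (e :* (β :* β′ :* t :* u)))
             refl e p q (1/! k) (1/! (n ∸ k)) β β′ (w ^ k) (v ^ (n ∸ k)) ⟩
      (p * 1/! k) * (q * 1/! (n ∸ k)) * (e * (β * β′ * w ^ k * v ^ (n ∸ k)))
        ≈⟨ *-congʳ (trans (*-cong (!-*-1/! k) (!-*-1/! (n ∸ k))) (*-identityˡ 1#)) ⟩
      1# * (e * (β * β′ * w ^ k * v ^ (n ∸ k)))
        ≈⟨ trans (*-identityˡ _) (trans (×-assoc-* (n C k) 1# _) (×-congʳ (n C k) (*-identityˡ _))) ⟩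
      (n C k) × (β * β′ * w ^ k * v ^ (n ∸ k)) ∎
      where
      e = (n C k) × 1#
      p = (k !) × 1#
      q = ((n ∸ k) !) × 1#
      β = eval (B k) x
      β′ = eval (B′ (n ∸ k)) y
      factorials : (n !) × 1# ≈ e * (p * q)
      factorials = trans (×-congˡ (n!≡nCk*k!*[n∸k]! k≤n))
        (trans (×1-homo-* (n C k) _) (*-congˡ (×1-homo-* (k !) ((n ∸ k) !))))

  -- Exhibited as an image under `j`, so that zero and unit can be told apart in `K`.
  denominator-0 : ∀ d η w → denominator d η w 0 ≈ j (η ^ᴷ d K.- K.1#)
  denominator-0 d η w = begin
    (constant (j (η ^ᴷ d)) *ˢ exp (d × 1# * w)) 0 - 1#
      ≈⟨ +-congʳ (trans (constant-* (j (η ^ᴷ d)) (exp (d × 1# * w)) 0)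
           (*-congˡ (trans (*-identityʳ _) ψ.1#-homo))) ⟩
    j (η ^ᴷ d) * 1# - 1#
      ≈⟨ +-cong (*-identityʳ _) (-‿cong (sym j.1#-homo)) ⟩
    j (η ^ᴷ d) - j K.1#
      ≈⟨ trans (j.+-homo _ _) (+-congˡ (j.-‿homo _)) ⟨
    j (η ^ᴷ d K.- K.1#) ∎

  denominator-1 : ∀ d η w → denominator d η w 1 ≈ j (η ^ᴷ d) * (d × 1# * w)
  denominator-1 d η w = begin
    (constant (j (η ^ᴷ d)) *ˢ exp (d × 1# * w)) 1 - 0#
      ≈⟨ +-cong (constant-* (j (η ^ᴷ d)) (exp (d × 1# * w)) 1) -0#≈0# ⟩
    j (η ^ᴷ d) * exp (d × 1# * w) 1 + 0#
      ≈⟨ +-identityʳ _ ⟩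
    j (η ^ᴷ d) * exp (d × 1# * w) 1
      ≈⟨ *-congˡ (trans (*-cong ψ.1#-homo (*-identityʳ _)) (*-identityˡ _)) ⟩
    j (η ^ᴷ d) * (d × 1# * w) ∎

  module _ (¬unit⇒≈0 : ¬Unit⇒≈0 K) (stable : Stable≈ A) where

    -- The `t`-coefficient `η^d d m` is a product of units: `η` by hypothesis, `d` and `m` as
    -- nonzero integers in a ℚ-algebra.
    denominator-cancel : ∀ d η m .{{_ : NonZero d}} .{{_ : NonZero m}} {η⁻¹} → η⁻¹ K.* η K.≈ K.1# → ∀ f g →
      denominator d η (m × 1#) *ˢ f ≈ˢ denominator d η (m × 1#) *ˢ g → f ≈ˢ g
    denominator-cancel d η m {η⁻¹} η⁻¹η≈1 f g = *ˢ-cancelˡ K ¬unit⇒≈0 j-isHom stable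
      (denominator d η (m × 1#)) f g (denominator-0 d η (m × 1#))
      (trans (*-congˡ (denominator-1 d η (m × 1#)))
        (unit-* A (j.unit-homo (unit-^ K d η⁻¹η≈1))
          (unit-* A (proj₂ (×1-unit d)) (proj₂ (×1-unit m)))))

    twistedBernoulli-symmetry : ∀ d χ .{{_ : NonZero d}} {η₁ η₂ η₁⁻¹ η₂⁻¹} →
      η₁⁻¹ K.* η₁ K.≈ K.1# → η₂⁻¹ K.* η₂ K.≈ K.1# →
      ∀ w₁ w₂ .{{_ : NonZero w₁}} .{{_ : NonZero w₂}} →
      ∀ B₁ → T.IsTwistedBernoulli d χ η₁ B₁ → ∀ B₂ → T.IsTwistedBernoulli d χ η₂ B₂ → ∀ x y n →
      SymmetryIdentity _≈_ _*_ 1# _^_ _×_ sum⁺-syntax eval B₁ B₂ w₁ w₂ x y n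
    twistedBernoulli-symmetry d χ {η₁} {η₂} η₁-unit η₂-unit w₁ w₂ B₁ isB₁ B₂ isB₂ x y n = symmetryIdentity (trans
      (sym (product-coefficient (w₂ × x) (w₁ × 1#) (w₁ × y) (w₂ × 1#) B₁ B₂ n))
      (trans (*-congˡ (products-agree n))
        (product-coefficient (w₁ × x) (w₂ × 1#) (w₂ × y) (w₁ × 1#) B₂ B₁ n)))
      where
      D₁ D₂ t₁ t₂ S₁ S₂ F₁ F₂ F₃ F₄ : Series
      D₁ = denominator d η₁ (w₁ × 1#)
      D₂ = denominator d η₂ (w₂ × 1#)
      t₁ = linear (w₁ × 1#)
      t₂ = linear (w₂ × 1#)
      S₁ = characterSum d χ η₁ (w₁ × 1#)
      S₂ = characterSum d χ η₂ (w₂ × 1#)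
      F₁ = At.rescale (w₂ × x) (w₁ × 1#) (T.egf B₁)
      F₂ = At.rescale (w₁ × y) (w₂ × 1#) (T.egf B₂)
      F₃ = At.rescale (w₁ × x) (w₂ × 1#) (T.egf B₂)
      F₄ = At.rescale (w₂ × y) (w₁ × 1#) (T.egf B₁)
      eq₁ : D₁ *ˢ F₁ ≈ˢ t₁ *ˢ exp (w₂ × x * (w₁ × 1#)) *ˢ S₁
      eq₁ = At.rescale-twistedBernoulli (w₂ × x) (w₁ × 1#) d χ η₁ B₁ isB₁
      eq₂ : D₂ *ˢ F₂ ≈ˢ t₂ *ˢ exp (w₁ × y * (w₂ × 1#)) *ˢ S₂
      eq₂ = At.rescale-twistedBernoulli (w₁ × y) (w₂ × 1#) d χ η₂ B₂ isB₂
      eq₃ : D₂ *ˢ F₃ ≈ˢ t₂ *ˢ exp (w₁ × x * (w₂ × 1#)) *ˢ S₂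
      eq₃ = At.rescale-twistedBernoulli (w₁ × x) (w₂ × 1#) d χ η₂ B₂ isB₂
      eq₄ : D₁ *ˢ F₄ ≈ˢ t₁ *ˢ exp (w₂ × y * (w₁ × 1#)) *ˢ S₁
      eq₄ = At.rescale-twistedBernoulli (w₂ × y) (w₁ × 1#) d χ η₁ B₁ isB₁
      products-agree : F₁ *ˢ F₂ ≈ˢ F₃ *ˢ F₄
      -- The inner application cancels `D₁`, after which the outer one cancels `D₂`.
      products-agree = denominator-cancel d η₂ w₂ η₂-unit (F₁ *ˢ F₂) (F₃ *ˢ F₄)
        (denominator-cancel d η₁ w₁ η₁-unit (D₂ *ˢ (F₁ *ˢ F₂)) (D₂ *ˢ (F₃ *ˢ F₄))
          (exchange-factors powerSeriesRing {D₁} {D₂} {F₁} {F₂} {F₃} {F₄} {t₁} {t₂}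
            {exp (w₂ × x * (w₁ × 1#))} {exp (w₁ × x * (w₂ × 1#))}
            {exp (w₁ × y * (w₂ × 1#))} {exp (w₂ × y * (w₁ × 1#))} {S₁} {S₂}
            -- The exponents agree: both are `w₁ w₂ x` in the first pair and `w₁ w₂ y` in the
            -- second.
            (exp-cong (×-*-×1-comm A w₂ w₁ x)) (exp-cong (×-*-×1-comm A w₁ w₂ y))
            eq₁ eq₂ eq₃ eq₄))

-- The symmetry in `K[y₁,y₂]`.

module BivariateSymmetry (K : CommutativeRing a ℓ) (¬unit⇒≈0 : ¬Unit⇒≈0 K) (≈-stable : Stable≈ K)
    (ι : ℚ → CommutativeRing.Carrier K) (ι-isHom : IsHom ℚ-ring K ι) where
  private
    module K = CommutativeRing K
  open TwistedBernoulli K ι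
  open BivariateNotation
  open Specialisation K K[y₁,y₂] ι ι-isHom
    (λ a → Polynomials.C K[y₁] (Polynomials.C K a)) (∘-isHom K K[y₁] K[y₁,y₂] (C-isHom K) (C-isHom K[y₁]))

  -- Equality of polynomials is coefficientwise, so stability is inherited from `K`.
  K[y₁,y₂]-stable : Stable≈ K[y₁,y₂]
  K[y₁,y₂]-stable f g ¬¬f≈g i k = ≈-stable _ _ λ fᵢₖ≉gᵢₖ → ¬¬f≈g λ f≈g → fᵢₖ≉gᵢₖ (f≈g i k)

  symmetry : ∀ d χ η₁ η₂ .{{_ : NonZero d}} w₁ w₂ .{{_ : NonZero w₁}} .{{_ : NonZero w₂}} →
    ∀ B₁ → IsTwistedBernoulli d χ η₁ B₁ → ∀ B₂ → IsTwistedBernoulli d χ η₂ B₂ →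
    ∀ {η₁⁻¹ η₂⁻¹} → η₁⁻¹ K.* η₁ K.≈ K.1# → η₂⁻¹ K.* η₂ K.≈ K.1# → ∀ n →
    SymmetryIdentity (TwistedBernoulli.BivariateNotation._≈_ K ι)
      (TwistedBernoulli.BivariateNotation._*_ K ι) (TwistedBernoulli.BivariateNotation.1# K ι)
      (TwistedBernoulli.BivariateNotation._^_ K ι) (TwistedBernoulli.BivariateNotation._×_ K ι)
      (TwistedBernoulli.BivariateNotation.sum⁺-syntax K ι) (TwistedBernoulli._⟨_⟩ K ι)
      B₁ B₂ w₁ w₂ (TwistedBernoulli.y₁ K ι) (TwistedBernoulli.y₂ K ι) n
  symmetry d χ η₁ η₂ w₁ w₂ B₁ isB₁ B₂ isB₂ {η₁⁻¹} {η₂⁻¹} η₁-unit η₂-unit n =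
    twistedBernoulli-symmetry ¬unit⇒≈0 K[y₁,y₂]-stable d χ {η₁} {η₂} {η₁⁻¹} {η₂⁻¹}
      η₁-unit η₂-unit w₁ w₂ B₁ isB₁ B₂ isB₂ y₁ y₂ n

-- The case of `ℂₚ`.

FieldEmbedding-isHom : {K : HeytingField a ℓ₁ ℓ₂} {L : HeytingField b ℓ₃ ℓ} (ι : FieldEmbedding K L) →
                       IsHom (ringOf K) (ringOf L) (FieldEmbedding.⟦_⟧ ι)
FieldEmbedding-isHom ι = FieldEmbedding.isRingHomomorphism ι .isSemiringHomomorphism
  where open RingMorphisms.IsRingHomomorphism

ℚ→ℂₚ-isHom : ∀ {p} (𝒞 : ComplexPadics p c ℓ₁ ℓ₂) →
             IsHom ℚ-ring (ringOf (ValuedField.field′ (ComplexPadics.ℂₚ 𝒞))) (ComplexPadics.ℚ→ℂₚ 𝒞)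
ℚ→ℂₚ-isHom 𝒞 = ∘-isHom ℚ-ring (ringOf ℚ̄ₚ.field′) (ringOf ℂₚ.field′)
  (∘-isHom ℚ-ring (ringOf ℚₚ.field′) (ringOf ℚ̄ₚ.field′) (FieldEmbedding-isHom ℚ↪ℚₚ) (FieldEmbedding-isHom ℚₚ↪ℚ̄ₚ))
  (FieldEmbedding-isHom ℚ̄ₚ↪ℂₚ)
  where open ComplexPadics 𝒞

-- The operations on K[y₁,y₂] are bound by name: opening BivariateNotation inside
-- the type would make copies of them that are only comparable by unfolding.
theorem1 :
  ∀ {c ℓ₁ ℓ₂ a a₁ a₂} (p : ℕ) → Prime p →
  (𝒞 : ComplexPadics p c ℓ₁ ℓ₂) →
  (ℚ̄ : HeytingField a a₁ a₂) (ℚ↪ℚ̄ : FieldEmbedding ℚ.heytingField ℚ̄) → IsAlgebraicClosure ℚ↪ℚ̄ →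
  (ℚ̄↪ℂₚ : FieldEmbedding ℚ̄ (ValuedField.field′ (ComplexPadics.ℂₚ 𝒞))) →
  (d : ℕ) → .{{NonZero d}} →
  (𝒳 : DirichletCharacter ℚ̄ d) → DirichletCharacter.IsPrimitive 𝒳 →
  let K = ringOf (ValuedField.field′ (ComplexPadics.ℂₚ 𝒞))
      open CommutativeRing K using (Carrier) renaming (_≈_ to _≈ₖ_)
      open CommutativeRing K using () renaming (1# to 1ₖ)
      open Exp (CommutativeRing.semiring K) using () renaming (_^_ to _^ₖ_)
      ι = ComplexPadics.ℚ→ℂₚ 𝒞
      open TwistedBernoulli K ι using (Polynomial; IsTwistedBernoulli)
      infix 4 _≈_
      infixl 7 _*_
      infixr 8 _^_ _×_
      infix 9 _⟨_⟩
      _≈_ = TwistedBernoulli.BivariateNotation._≈_ K ι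
      _*_ = TwistedBernoulli.BivariateNotation._*_ K ι
      1# = TwistedBernoulli.BivariateNotation.1# K ι
      _^_ = TwistedBernoulli.BivariateNotation._^_ K ι
      _×_ = TwistedBernoulli.BivariateNotation._×_ K ι
      sum⁺ = TwistedBernoulli.BivariateNotation.sum⁺-syntax K ι
      syntax sum⁺ n (λ k → x) = ∑[ k ≤ n ] x
      y₁ = TwistedBernoulli.y₁ K ι
      y₂ = TwistedBernoulli.y₂ K ι
      _⟨_⟩ = TwistedBernoulli._⟨_⟩ K ι
      χ = λ m → FieldEmbedding.⟦_⟧ ℚ̄↪ℂₚ (DirichletCharacter.χ 𝒳 m)
  in
  (r : ℕ) → .{{NonZero r}} → gcd r (p *ℕ d) ≡ 1 →
  (ξ : Carrier) → ξ ^ₖ r ≈ₖ 1ₖ → ¬ (ξ ≈ₖ 1ₖ) →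
  (w₁ w₂ : ℕ) → .{{NonZero w₁}} → .{{NonZero w₂}} → ¬ (r ∣ w₁) → ¬ (r ∣ w₂) →
  (B₁ : ℕ → Polynomial) → IsTwistedBernoulli d χ (ξ ^ₖ w₁) B₁ →
  (B₂ : ℕ → Polynomial) → IsTwistedBernoulli d χ (ξ ^ₖ w₂) B₂ →
  (n : ℕ) →
    ∑[ k ≤ n ] ((n C toℕ k) × ((B₁ (toℕ k) ⟨ w₂ × y₁ ⟩) * (B₂ (n ∸ toℕ k) ⟨ w₁ × y₂ ⟩) * (w₁ × 1#) ^ toℕ k * (w₂ × 1#) ^ (n ∸ toℕ k)))
      ≈
    ∑[ k ≤ n ] ((n C toℕ k) × ((B₂ (toℕ k) ⟨ w₁ × y₁ ⟩) * (B₁ (n ∸ toℕ k) ⟨ w₂ × y₂ ⟩) * (w₂ × 1#) ^ toℕ k * (w₁ × 1#) ^ (n ∸ toℕ k)))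
theorem1 p _ 𝒞 ℚ̄ _ _ ℚ̄↪ℂₚ d 𝒳 _ r _ ξ ξʳ≈1 _ w₁ w₂ _ _ B₁ isB₁ B₂ isB₂ n = identity
  where
  ℂₚ = ValuedField.field′ (ComplexPadics.ℂₚ 𝒞)
  -- A root of unity is invertible, and so are the twists `ξ^w₁` and `ξ^w₂`, as the cancellation of
  -- the denominators demands.
  ξ-unit = proj₂ (rootOfUnity-unit (ringOf ℂₚ) {ξ} r ξʳ≈1)
  symmetry = BivariateSymmetry.symmetry (ringOf (ValuedField.field′ (ComplexPadics.ℂₚ 𝒞)))
    (HeytingField-¬Unit⇒≈0 ℂₚ) (HeytingField-stable≈ ℂₚ) (ComplexPadics.ℚ→ℂₚ 𝒞) (ℚ→ℂₚ-isHom 𝒞)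
    d (λ m → FieldEmbedding.⟦_⟧ ℚ̄↪ℂₚ (DirichletCharacter.χ 𝒳 m)) _ _ w₁ w₂ B₁ isB₁ B₂ isB₂
    (unit-^ (ringOf ℂₚ) w₁ ξ-unit) (unit-^ (ringOf ℂₚ) w₂ ξ-unit) n
  identity = SymmetryIdentity.identity symmetry
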